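{- There is no isomorphism (in the category of pcas and applicative morphisms) between the pcas $2^\omega$ and $\mathcal{K}_2$.
   Context: A partial combinatory algebra (pca) is a set $\mathcal{A}$ with a partial binary application $(a,b)\mapsto ab$ (associating to the left) such that there are $\mathsf{k},\mathsf{s}\in\mathcal{A}$ with, for all $a,b,c$: $\mathsf{k}ab=a$; $\mathsf{s}ab$ is defined; and whenever $(ac)(bc)$ is defined, $\mathsf{s}abc$ is defined and equals $(ac)(bc)$. An applicative morphism $\gamma:\mathcal{A}\to\mathcal{B}$ of pcas assigns to every $a\in\mathcal{A}$ a nonempty subset $\gamma(a)\subseteq\mathcal{B}$ such that there is $r\in\mathcal{B}$ with: whenever $aa'$ is defined in $\mathcal{A}$, $b\in\gamma(a)$, $b'\in\gamma(a')$, then $rbb'$ is defined and lies in $\gamma(aa')$. Composition is composition of relations and identities are identity relations; an isomorphism is an applicative morphism with a two-sided inverse applicative morphism, both composites being equal to the identity relations. Below $[\cdot,\ldots,\cdot]$ is a standard coding of finite sequences of natural numbers by natural numbers. $\mathcal{K}_2$ (Kleene's second model): underlying set $\mathbb{N}^{\mathbb{N}}$; $\alpha\beta$ is defined iff for every $n$ there is $k$ with $\alpha([n,\beta(0),\ldots,\beta(k-1)])>0$, and then $(\alpha\beta)(n)=\alpha([n,\beta(0),\ldots,\beta(k-1)])-1$ for the least such $k$. $2^\omega$: underlying set $\{0,1\}^{\mathbb{N}}$; $\alpha\cdot\beta$ is defined iff for every $n$ there is $k$ with $\alpha([n,\beta(0),\ldots,\beta(k-1)])=1$, and then $(\alpha\cdot\beta)(n)=\alpha([n,\beta(0),\ldots,\beta(k)])$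 for the least such $k$. -}

module Defs where

open import Data.Empty using (⊥; ⊥-elim)
open import Data.Fin using (Fin; toℕ)
open import Data.Fin.Patterns using (0F; 1F)
import Data.Fin.Properties as Fin
open import Data.List using (List; []; _∷_; _∷ʳ_; applyUpTo; length; map)
open import Data.List.Properties using (map-applyUpTo; length-applyUpTo; applyUpTo-∷ʳ)
open import Data.Maybe using (Maybe; just; nothing; maybe)
open import Data.Maybe.Properties using (just-injective)
open import Data.Nat using (ℕ; zero; suc; _+_; _∸_; _≤_; _<_; _>_; z≤n; s≤s; _⊔_; _<?_; s<s⁻¹)
open import Data.Nat.Properties
open import Data.Product using (∃; ∃₂; _×_; _,_; proj₁; proj₂)
open import Data.Sum using (_⊎_; inj₁; inj₂; [_,_]′)
open import Function using (_∘_; id)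
open import Function.Bundles using (_↪_; RightInverse)
open import Level using (Level; 0ℓ) renaming (suc to lsuc; _⊔_ to _⊔ˡ_)
open import Relation.Binary using (Setoid; REL; Rel; _⇔_; tri<; tri≈; tri>)
open import Relation.Binary.Construct.Composition using (_;_)
open import Relation.Binary.PropositionalEquality using (_≡_; refl; sym; trans; cong; cong₂; subst; _≗_; _→-setoid_)
open import Relation.Nullary using (¬_; Dec; yes; no)

-- The partial application is given by its graph: a · b ↦ c says that ab is
-- defined and equal to c, so ab is defined iff a · b ↦ c for some c.  Equality
-- is a setoid equality because functions are compared pointwise below.

record PCA (c ℓ : Level) : Set (lsuc (c ⊔ˡ ℓ)) where
  field
    setoid : Setoid c ℓ
  open Setoid setoid public using (Carrier; _≈_)
  infix 4 _·_↦_
  field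
    _·_↦_        : Carrier → Carrier → Carrier → Set ℓ
    ↦-resp       : ∀ {a a′ b b′ c c′} → a ≈ a′ → b ≈ b′ → c ≈ c′ →
                   a · b ↦ c → a′ · b′ ↦ c′
    ↦-functional : ∀ {a b c c′} → a · b ↦ c → a · b ↦ c′ → c ≈ c′
    k            : Carrier
    k-law        : ∀ a b → ∃ λ ka → k · a ↦ ka × ka · b ↦ a
    s            : Carrier
    s-law        : ∀ a b → ∃₂ λ sa sab → s · a ↦ sa × sa · b ↦ sab ×
                   (∀ {c ac bc d} → a · c ↦ ac → b · c ↦ bc → ac · bc ↦ d →
                    sab · c ↦ d)

module _ {c₁ ℓ₁ c₂ ℓ₂ : Level} where

  -- γ a b is read "b ∈ γ(a)"; subsets are predicates valued in Set p.

  record ApplicativeMorphism (p : Level) (𝒜 : PCA c₁ ℓ₁) (ℬ : PCA c₂ ℓ₂)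
         : Set (c₁ ⊔ˡ ℓ₁ ⊔ˡ c₂ ⊔ˡ ℓ₂ ⊔ˡ lsuc p) where
    private
      module A = PCA 𝒜
      module B = PCA ℬ
    field
      γ        : REL A.Carrier B.Carrier p
      γ-resp   : ∀ {a a′ b b′} → a A.≈ a′ → b B.≈ b′ → γ a b → γ a′ b′
      nonempty : ∀ a → ∃ λ b → γ a b
      realizer : ∃ λ r → ∀ {a a′ aa′ b b′} → a A.· a′ ↦ aa′ → γ a b → γ a′ b′ →
                 ∃₂ λ rb rbb′ → r B.· b ↦ rb × rb B.· b′ ↦ rbb′ × γ aa′ rbb′

-- Morphisms are equal when their underlying relations are; the identity on 𝒜
-- has underlying relation _≈_.

record Isomorphism {c₁ ℓ₁ c₂ ℓ₂ : Level} (p : Level) (𝒜 : PCA c₁ ℓ₁) (ℬ : PCA c₂ ℓ₂)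
       : Set (c₁ ⊔ˡ ℓ₁ ⊔ˡ c₂ ⊔ˡ ℓ₂ ⊔ˡ lsuc p) where
  private
    module A = PCA 𝒜
    module B = PCA ℬ
  field
    to   : ApplicativeMorphism p 𝒜 ℬ
    from : ApplicativeMorphism p ℬ 𝒜
  private
    module T = ApplicativeMorphism to
    module F = ApplicativeMorphism from
  field
    from∘to : (T.γ ; F.γ) ⇔ A._≈_
    to∘from : (F.γ ; T.γ) ⇔ B._≈_

Least : ∀ {ℓ} → (ℕ → Set ℓ) → ℕ → Set ℓ
Least P k = P k × (∀ {j} → j < k → ¬ P j)

-- A coding is an injection List ℕ → ℕ together with a decoding function that is
-- a left inverse of it; it need not be surjective.

module _ (coding : List ℕ ↪ ℕ) where
  open RightInverse coding using () renaming (to to ⟦_⟧)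

  𝒦₂-app : (α β γ : ℕ → ℕ) → Set
  𝒦₂-app α β γ = ∀ n → ∃ λ k →
    Least (λ j → α ⟦ n ∷ applyUpTo β j ⟧ > 0) k ×
    γ n ≡ α ⟦ n ∷ applyUpTo β k ⟧ ∸ 1

  -- The value is read one step further: its sequence ends in β(k).

  2^ω-app : (α β γ : ℕ → Fin 2) → Set
  2^ω-app α β γ = ∀ n → ∃ λ k →
    Least (λ j → α ⟦ n ∷ applyUpTo (toℕ ∘ β) j ⟧ ≡ 1F) k ×
    γ n ≡ α ⟦ n ∷ applyUpTo (toℕ ∘ β) (suc k) ⟧

------------------------------------------------------------------------
-- Existence of k and s, for both applications at once.

-- Computations that may query an oracle Q → X finitely often.

module Dialogue (X : Set) where

  data D (Q R : Set) : Set where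
    ret : R → D Q R
    ask : Q → (X → D Q R) → D Q R

  private variable Q R R′ : Set

  infixl 1 _>>=_ _>>=?_

  _>>=_ : D Q R → (R → D Q R′) → D Q R′
  ret r   >>= g = g r
  ask q f >>= g = ask q (λ x → f x >>= g)

  _>>=?_ : D Q (Maybe R) → (R → D Q (Maybe R′)) → D Q (Maybe R′)
  m >>=? g = m >>= maybe g (ret nothing)

  run : (Q → X) → D Q R → R
  run o (ret r)   = r
  run o (ask q f) = run o (f (o q))

  run->>= : (o : Q → X) (m : D Q R) {g : R → D Q R′} →
            run o (m >>= g) ≡ run o (g (run o m))
  run->>= o (ret r)   = refl
  run->>= o (ask q f) = run->>= o (f (o q))

  run->>=? : (o : Q → X) (m : D Q (Maybe R)) {g : R → D Q (Maybe R′)} {x : R} →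
             run o m ≡ just x → run o (m >>=? g) ≡ run o (g x)
  run->>=? o m {g} eq =
    trans (run->>= o m) (cong (run o ∘ maybe g (ret nothing)) eq)

  run->>=?⁻ : (o : Q → X) (m : D Q (Maybe R)) {g : R → D Q (Maybe R′)} {v : R′} →
              run o (m >>=? g) ≡ just v →
              ∃ λ x → run o m ≡ just x × run o (g x) ≡ just v
  run->>=?⁻ o m eq with run o m | run->>= o m
  ... | just x  | e = x , refl , trans (sym e) eq
  ... | nothing | e with () ← trans (sym e) eq

  nth : List X → ℕ → Maybe X
  nth []       _       = nothing
  nth (x ∷ _)  zero    = just x
  nth (_ ∷ xs) (suc i) = nth xs i

  -- Answer the queries to the last oracle from a finite prefix of it.

  restrict : List X → D (Q ⊎ ℕ) R → D Q (Maybe R)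
  restrict u (ret r)          = ret (just r)
  restrict u (ask (inj₁ q) f) = ask q (λ x → restrict u (f x))
  restrict u (ask (inj₂ i) f) = maybe (λ x → restrict u (f x)) (ret nothing) (nth u i)

  nth-sound : ∀ (β : ℕ → X) k i {x} → nth (applyUpTo β k) i ≡ just x → x ≡ β i
  nth-sound β (suc k) zero    refl = refl
  nth-sound β (suc k) (suc i) eq   = nth-sound (β ∘ suc) k i eq

  nth-complete : ∀ (β : ℕ → X) {k i} → i < k → nth (applyUpTo β k) i ≡ just (β i)
  nth-complete β {suc k} {zero}  _       = refl
  nth-complete β {suc k} {suc i} (s≤s p) = nth-complete (β ∘ suc) p

  module _ (o : Q → X) (β : ℕ → X) where

    restrict-sound : ∀ k (t : D (Q ⊎ ℕ) R) {r} →
                     run o (restrict (applyUpTo β k) t) ≡ just r →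
                     run [ o , β ]′ t ≡ r
    restrict-sound k (ret r)          eq = just-injective eq
    restrict-sound k (ask (inj₁ q) f) eq = restrict-sound k (f (o q)) eq
    restrict-sound k (ask (inj₂ i) f) eq with nth (applyUpTo β k) i in e
    ... | just x rewrite nth-sound β k i e = restrict-sound k (f (β i)) eq
    restrict-sound k (ask (inj₂ i) f) () | nothing

    restrict-complete : (t : D (Q ⊎ ℕ) R) → ∃ λ K → ∀ {k} → K ≤ k →
                        run o (restrict (applyUpTo β k) t) ≡ just (run [ o , β ]′ t)
    restrict-complete (ret r)          = 0 , λ _ → refl
    restrict-complete (ask (inj₁ q) f) = restrict-complete (f (o q))
    restrict-complete (ask (inj₂ i) f) with restrict-complete (f (β i))
    ... | K , h = suc i ⊔ K , λ {k} le →
      trans (cong (λ m → run o (maybe (λ x → restrict (applyUpTo β k) (f x)) (ret nothing) m))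
                  (nth-complete β (≤-trans (m≤m⊔n (suc i) K) le)))
            (h (≤-trans (m≤n⊔m (suc i) K) le))

applyUpTo-cong : ∀ {A : Set} {f g : ℕ → A} → f ≗ g → applyUpTo f ≗ applyUpTo g
applyUpTo-cong eq zero    = refl
applyUpTo-cong eq (suc k) = cong₂ _∷_ (eq 0) (applyUpTo-cong (eq ∘ suc) k)

dropLast : ∀ {A : Set} → List A → List A
dropLast []           = []
dropLast (x ∷ [])     = []
dropLast (x ∷ y ∷ ys) = x ∷ dropLast (y ∷ ys)

dropLast-applyUpTo : ∀ {A : Set} (f : ℕ → A) k →
                     dropLast (applyUpTo f (suc k)) ≡ applyUpTo f k
dropLast-applyUpTo f zero    = refl
dropLast-applyUpTo f (suc k) = cong (f 0 ∷_) (dropLast-applyUpTo (f ∘ suc) k)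

least : ∀ {P : ℕ → Set} → (∀ k → Dec (P k)) → ∀ k → P k → ∃ (Least P)
least P? zero p = 0 , p , λ ()
least {P} P? (suc k) p with P? 0
... | yes p₀ = 0 , p₀ , λ ()
... | no ¬p₀ with least (P? ∘ suc) k p
...   | m , pm , below = suc m , pm , below′
  where
  below′ : ∀ {j} → j < suc m → ¬ P j
  below′ {zero}  _ = ¬p₀
  below′ {suc j} q = below (s<s⁻¹ q)

least-unique : ∀ {ℓ} {P : ℕ → Set ℓ} {k k′} → Least P k → Least P k′ → k ≡ k′
least-unique {k = k} {k′} (p , h) (p′ , h′) with <-cmp k k′
... | tri< lt _ _ = ⊥-elim (h′ lt p)
... | tri≈ _ eq _ = eq
... | tri> _ _ gt = ⊥-elim (h gt p′)

prev : {A : Set} → (ℕ → Maybe A) → ℕ → Maybe A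
prev h zero    = nothing
prev h (suc k) = h k

Eventually : (ℕ → Set) → Set
Eventually P = ∃ λ J → ∀ {j} → J ≤ j → P j

eventually-∀≤ : {P : ℕ → ℕ → Set} → (∀ i → Eventually (P i)) →
                ∀ k → Eventually (λ j → ∀ {i} → i ≤ k → P i j)
eventually-∀≤ ev zero with ev 0
... | J , h = J , λ where le z≤n → h le
eventually-∀≤ {P} ev (suc k) with ev 0 | eventually-∀≤ {P ∘ suc} (ev ∘ suc) k
... | J , h | J′ , h′ = J ⊔ J′ , λ where
  le {zero}  _       → h  (≤-trans (m≤m⊔n J J′) le)
  le {suc i} (s≤s p) → h′ (≤-trans (m≤n⊔m J J′) le) p

-- Stop is the halting condition, look k the length of the prefix at which the
-- value is read, and post turns what is read there into the value.  An element
-- representing a given computation answers enc p c on the code of n ∷ u, where c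
-- is the outcome of the computation at n on u and p that on u minus its last entry.

module Construction
  (coding : List ℕ ↪ ℕ) {X : Set}
  (ι : X → ℕ) (κ : ℕ → X) (κ∘ι : ∀ x → κ (ι x) ≡ x)
  (Stop : X → Set) (stop? : ∀ x → Dec (Stop x))
  (look : ℕ → ℕ) (ext : List X → X → List X)
  (ext-applyUpTo : ∀ β k → ext (applyUpTo β k) (β k) ≡ applyUpTo β (look k))
  (post : X → X) (enc : Maybe X → Maybe X → X)
  (enc-go : ¬ Stop (enc nothing nothing))
  (enc-stop : ∀ v → Stop (enc nothing (just v)))
  (enc-out : ∀ h k v → h k ≡ just v → (∀ {j} → j < k → h j ≡ nothing) →
             post (enc (prev h (look k)) (h (look k))) ≡ v)
  where

  open RightInverse coding using () renaming (to to ⟦_⟧; from to decode; strictlyInverseʳ to decode∘code)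
  open Dialogue X

  infix 4 _·_↦_
  _·_↦_ : (α β γ : ℕ → X) → Set
  α · β ↦ γ = ∀ n → ∃ λ k →
    Least (λ j → Stop (α ⟦ n ∷ applyUpTo (ι ∘ β) j ⟧)) k ×
    γ n ≡ post (α ⟦ n ∷ applyUpTo (ι ∘ β) (look k) ⟧)

  ·↦-resp : ∀ {α α′ β β′ γ γ′} → α ≗ α′ → β ≗ β′ → γ ≗ γ′ → α · β ↦ γ → α′ · β′ ↦ γ′
  ·↦-resp {α} {α′} {β} {β′} α≗ β≗ γ≗ app n with app n
  ... | k , (p , below) , val =
    k , (subst Stop (same k) p , λ {j} lt q → below lt (subst Stop (sym (same j)) q)) ,
    trans (sym (γ≗ n)) (trans val (cong post (same (look k))))
    where
    same : ∀ j → α ⟦ n ∷ applyUpTo (ι ∘ β) j ⟧ ≡ α′ ⟦ n ∷ applyUpTo (ι ∘ β′) j ⟧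
    same j = trans (α≗ _) (cong (λ w → α′ ⟦ n ∷ w ⟧) (applyUpTo-cong (cong ι ∘ β≗) j))

  ·↦-functional : ∀ {α β γ γ′} → α · β ↦ γ → α · β ↦ γ′ → γ ≗ γ′
  ·↦-functional app app′ n with app n | app′ n
  ... | k , l , val | k′ , l′ , val′ with least-unique l l′
  ...   | refl = trans val (sym val′)

  private variable Q : Set

  orElse : Maybe (Maybe X) → D Q (Maybe X) → D Q (Maybe X)
  orElse (just (just v)) _ = ret (just v)
  orElse (just nothing)  m = m
  orElse nothing         m = m

  dovetail : (ℕ → D (Q ⊎ ℕ) (Maybe X)) → ℕ → List X → D Q (Maybe X)
  dovetail Φ zero    u = ret nothing
  dovetail Φ (suc j) u = restrict u (Φ j) >>= λ r → orElse r (dovetail Φ j u)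

  module _ (o : Q → X) (β : ℕ → X) (Φ : ℕ → D (Q ⊎ ℕ) (Maybe X)) where

    dovetail-sound : ∀ J k {v} → run o (dovetail Φ J (applyUpTo β k)) ≡ just v →
                     ∃ λ j → run [ o , β ]′ (Φ j) ≡ just v
    dovetail-sound (suc J) k eq
      with run o (restrict (applyUpTo β k) (Φ J)) in e
         | trans (sym (run->>= o (restrict (applyUpTo β k) (Φ J)))) eq
    ... | just (just v) | refl = J , restrict-sound o β k (Φ J) e
    ... | just nothing  | eq′  = dovetail-sound J k eq′
    ... | nothing       | eq′  = dovetail-sound J k eq′

    dovetail-complete : ∀ J k {j v} → j < J →
                        run o (restrict (applyUpTo β k) (Φ j)) ≡ just (just v) →
                        ∃ λ v′ → run o (dovetail Φ J (applyUpTo β k)) ≡ just v′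
    dovetail-complete (suc J) k {j} lt eq
      rewrite run->>= o (restrict (applyUpTo β k) (Φ J))
                        {λ r → orElse r (dovetail Φ J (applyUpTo β k))}
      with run o (restrict (applyUpTo β k) (Φ J)) in e | m≤n⇒m<n∨m≡n (≤-pred lt)
    ... | just (just v) | _         = v , refl
    ... | just nothing  | inj₁ lt′  = dovetail-complete J k lt′ eq
    ... | nothing       | inj₁ lt′  = dovetail-complete J k lt′ eq
    ... | just nothing  | inj₂ refl with () ← trans (sym e) eq
    ... | nothing       | inj₂ refl with () ← trans (sym e) eq

  prevD : (List X → D Q (Maybe X)) → List X → D Q (Maybe X)
  prevD h []       = ret nothing
  prevD h (x ∷ xs) = h (dropLast (x ∷ xs))

  bodyList : (ℕ → List X → D Q (Maybe X)) → List ℕ → D Q X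
  bodyList h []      = ret (enc nothing nothing)
  bodyList h (n ∷ u) = prevD (h n) (map κ u) >>= λ p → h n (map κ u) >>= λ c → ret (enc p c)

  body : (ℕ → List X → D Q (Maybe X)) → ℕ → D Q X
  body h z = bodyList h (decode z)

  body-correct : (o : Q → X) (h : ℕ → List X → D Q (Maybe X)) (n : ℕ) (β : ℕ → X) (k : ℕ) →
                 let H = λ j → run o (h n (applyUpTo β j)) in
                 run o (body h ⟦ n ∷ applyUpTo (ι ∘ β) k ⟧) ≡ enc (prev H k) (H k)
  body-correct {Q} o h n β k
    rewrite decode∘code (n ∷ applyUpTo (ι ∘ β) k)
          | map-applyUpTo (ι ∘ β) κ k
          | applyUpTo-cong {f = κ ∘ ι ∘ β} {β} (κ∘ι ∘ β) k
    = trans (run->>= o (prevD (h n) (applyUpTo β k)))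
            (trans (run->>= o (h n (applyUpTo β k)))
                   (cong (λ p → enc p (run o (h n (applyUpTo β k)))) (prev-correct k)))
    where
    prev-correct : ∀ k → run o (prevD (h n) (applyUpTo β k)) ≡
                         prev (λ j → run o (h n (applyUpTo β j))) k
    prev-correct zero    = refl
    prev-correct (suc k) = cong (run o ∘ h n) (dropLast-applyUpTo β k)

  -- Abstraction over the last oracle; Φ j is the j-th approximation.

  lam : (ℕ → ℕ → D (Q ⊎ ℕ) (Maybe X)) → ℕ → D Q X
  lam Φ = body (λ n u → dovetail (λ j → Φ j n) (length u) u)

  lam-correct : (o : Q → X) (Φ : ℕ → ℕ → D (Q ⊎ ℕ) (Maybe X)) (β γ : ℕ → X) →
                (∀ j n {v} → run [ o , β ]′ (Φ j n) ≡ just v → v ≡ γ n) →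
                (∀ n → ∃ λ j → run [ o , β ]′ (Φ j n) ≡ just (γ n)) →
                (run o ∘ lam Φ) · β ↦ γ
  lam-correct {Q} o Φ β γ sound complete n
    with complete n
  ... | j , e with restrict-complete o β (Φ j n)
  ... | K , r = k , (stop , below) , sym out
    where
    h : ℕ → List X → D Q (Maybe X)
    h n u = dovetail (λ j → Φ j n) (length u) u

    H : ℕ → Maybe X
    H k = run o (h n (applyUpTo β k))

    Halts : ℕ → Set
    Halts k = ∃ λ v → H k ≡ just v

    halts? : ∀ k → Dec (Halts k)
    halts? k with H k
    ... | just v  = yes (v , refl)
    ... | nothing = no λ ()

    H-nothing : ∀ {k} → ¬ Halts k → H k ≡ nothing
    H-nothing {k} ¬p with H k
    ... | just v  = ⊥-elim (¬p (v , refl))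
    ... | nothing = refl

    halts : Halts (suc j ⊔ K)
    halts rewrite length-applyUpTo β (suc j ⊔ K) =
      dovetail-complete o β (λ j → Φ j n) (suc j ⊔ K) (suc j ⊔ K) (m≤m⊔n (suc j) K)
        (trans (r (m≤n⊔m (suc j) K)) (cong just e))

    found : ∃ (Least Halts)
    found = least halts? (suc j ⊔ K) halts

    k : ℕ
    k = proj₁ found

    v : X
    v = proj₁ (proj₁ (proj₂ found))

    Hk : H k ≡ just v
    Hk = proj₂ (proj₁ (proj₂ found))

    Hj : ∀ {j} → j < k → H j ≡ nothing
    Hj {j} lt = H-nothing {j} (proj₂ (proj₂ found) lt)

    prev-nothing : ∀ {m} → m ≤ k → prev H m ≡ nothing
    prev-nothing {zero}  _  = refl
    prev-nothing {suc m} le = Hj le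

    v≡γn : v ≡ γ n
    v≡γn with dovetail-sound o β (λ j → Φ j n) (length (applyUpTo β k)) k Hk
    ... | j′ , e′ = sound j′ n e′

    stop : Stop (run o (lam Φ ⟦ n ∷ applyUpTo (ι ∘ β) k ⟧))
    stop rewrite body-correct o h n β k | prev-nothing (≤-refl {k}) =
      subst (λ c → Stop (enc nothing c)) (sym Hk) (enc-stop v)

    below : ∀ {j} → j < k → ¬ Stop (run o (lam Φ ⟦ n ∷ applyUpTo (ι ∘ β) j ⟧))
    below {j} lt rewrite body-correct o h n β j | prev-nothing (<⇒≤ lt) =
      subst (λ c → ¬ Stop (enc nothing c)) (sym (Hj lt)) enc-go

    out : post (run o (lam Φ ⟦ n ∷ applyUpTo (ι ∘ β) (look k) ⟧)) ≡ γ n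
    out rewrite body-correct o h n β (look k) = trans (enc-out H k v Hk Hj) v≡γn

  lamTotal : (ℕ → D (Q ⊎ ℕ) X) → ℕ → D Q X
  lamTotal t = lam (λ _ n → t n >>= (ret ∘ just))

  lamTotal-correct : (o : Q → X) (t : ℕ → D (Q ⊎ ℕ) X) (β : ℕ → X) →
                     (run o ∘ lamTotal t) · β ↦ (run [ o , β ]′ ∘ t)
  lamTotal-correct o t β = lam-correct o _ β _
    (λ j n e → just-injective (trans (sym e) (run->>= _ (t n))))
    (λ n → 0 , run->>= _ (t n))

  search : (F G : ℕ → D Q (Maybe X)) (n fuel : ℕ) → List X → D Q (Maybe X)
  decide : (F G : ℕ → D Q (Maybe X)) (n fuel : ℕ) → List X → X → {x : X} → Dec (Stop x) → D Q (Maybe X)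
  search F G n zero       w = ret nothing
  search F G n (suc fuel) w =
    F ⟦ n ∷ map ι w ⟧ >>=? λ x → G (length w) >>=? λ b → decide F G n fuel w b (stop? x)
  decide F G n fuel w b (yes _) = F ⟦ n ∷ map ι (ext w b) ⟧ >>=? (ret ∘ just ∘ post)
  decide F G n fuel w b (no _)  = search F G n fuel (w ∷ʳ b)

  record Approximates (o : Q → X) (F : ℕ → ℕ → D Q (Maybe X)) (α : ℕ → X) : Set where
    field
      sound    : ∀ j n {v} → run o (F j n) ≡ just v → v ≡ α n
      complete : ∀ n → Eventually (λ j → run o (F j n) ≡ just (α n))
  open Approximates

  apply : (F G : ℕ → ℕ → D Q (Maybe X)) → ℕ → ℕ → D Q (Maybe X)
  apply F G j n = search (F j) (G j) n j []

  module _ {o : Q → X} {F G : ℕ → ℕ → D Q (Maybe X)} {α β γ : ℕ → X}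
           (F≈α : Approximates o F α) (G≈β : Approximates o G β) (app : α · β ↦ γ) where
    private
      P : ℕ → ℕ → Set
      P n k = Stop (α ⟦ n ∷ applyUpTo (ι ∘ β) k ⟧)

      search-sound : ∀ j n fuel k {v} → (∀ {i} → i < k → ¬ P n i) →
                     run o (search (F j) (G j) n fuel (applyUpTo β k)) ≡ just v → v ≡ γ n
      search-sound j n (suc fuel) k below eq
        with run->>=?⁻ o (F j _) eq
      ... | x , ex , eq₁ with run->>=?⁻ o (G j _) eq₁
      ... | b , eb , eq₂
        with sound F≈α j _ ex | sound G≈β j _ eb
      ... | refl | refl
        rewrite length-applyUpTo β k | map-applyUpTo β ι k
        with stop? (α ⟦ n ∷ applyUpTo (ι ∘ β) k ⟧)
      ... | yes p with run->>=?⁻ o (F j _) eq₂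
      ...   | y , ey , refl with sound F≈α j _ ey
      ...   | refl rewrite ext-applyUpTo β k | map-applyUpTo β ι (look k)
              with app n
      ...   | k′ , l , val with least-unique {P = P n} (p , below) l
      ...   | refl = sym val
      search-sound j n (suc fuel) k below eq | x , ex , eq₁ | b , eb , eq₂ | refl | refl | no ¬p
        rewrite applyUpTo-∷ʳ β k = search-sound j n fuel (suc k) below′ eq₂
        where
        below′ : ∀ {i} → i < suc k → ¬ P n i
        below′ lt with m≤n⇒m<n∨m≡n (≤-pred lt)
        ... | inj₁ lt′  = below lt′
        ... | inj₂ refl = ¬p

      search-complete : ∀ j n k → Least (P n) k → γ n ≡ post (α ⟦ n ∷ applyUpTo (ι ∘ β) (look k) ⟧) →
        (∀ {i} → i ≤ k → run o (F j ⟦ n ∷ applyUpTo (ι ∘ β) i ⟧) ≡ just (α ⟦ n ∷ applyUpTo (ι ∘ β) i ⟧)) →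
        run o (F j ⟦ n ∷ applyUpTo (ι ∘ β) (look k) ⟧) ≡ just (α ⟦ n ∷ applyUpTo (ι ∘ β) (look k) ⟧) →
        (∀ {i} → i ≤ k → run o (G j i) ≡ just (β i)) →
        ∀ d i fuel → i + d ≡ k → d < fuel →
        run o (search (F j) (G j) n fuel (applyUpTo β i)) ≡ just (γ n)
      search-complete j n k (stop , below) val hF hL hG d i (suc fuel) eq lt
        rewrite map-applyUpTo β ι i | length-applyUpTo β i =
        trans (run->>=? o (F j _) (hF i≤k)) (trans (run->>=? o (G j i) (hG i≤k)) (step d eq lt))
        where
        i≤k : i ≤ k
        i≤k = subst (i ≤_) eq (m≤m+n i d)
        step : ∀ d → i + d ≡ k → d < suc fuel →
          run o (decide (F j) (G j) n fuel (applyUpTo β i) (β i)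
                        (stop? (α ⟦ n ∷ applyUpTo (ι ∘ β) i ⟧))) ≡ just (γ n)
        step zero eq _ with trans (sym (+-identityʳ i)) eq
        ... | refl with stop? (α ⟦ n ∷ applyUpTo (ι ∘ β) i ⟧)
        ...   | no ¬p = ⊥-elim (¬p stop)
        ...   | yes _ rewrite ext-applyUpTo β i | map-applyUpTo β ι (look i) =
          trans (run->>=? o (F j _) hL) (cong just (sym val))
        step (suc d) eq (s≤s lt) with stop? (α ⟦ n ∷ applyUpTo (ι ∘ β) i ⟧)
        ... | yes p = ⊥-elim (below (subst (i <_) eq (m<m+n i (s≤s z≤n))) p)
        ... | no _ rewrite applyUpTo-∷ʳ β i =
          search-complete j n k (stop , below) val hF hL hG d (suc i) fuel
            (trans (sym (+-suc i d)) eq) lt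

    apply-approximates : Approximates o (apply F G) γ
    sound apply-approximates j n eq = search-sound j n j 0 (λ ()) eq
    complete apply-approximates n with app n
    ... | k , l , val
      with eventually-∀≤ (λ i → complete F≈α ⟦ n ∷ applyUpTo (ι ∘ β) i ⟧) k
         | complete F≈α ⟦ n ∷ applyUpTo (ι ∘ β) (look k) ⟧
         | eventually-∀≤ (complete G≈β) k
    ... | J₁ , h₁ | J₂ , h₂ | J₃ , h₃ =
      suc k ⊔ (J₁ ⊔ (J₂ ⊔ J₃)) , λ {j} le →
        let le′ = ≤-trans (m≤n⊔m (suc k) (J₁ ⊔ (J₂ ⊔ J₃))) le
            le″ = ≤-trans (m≤n⊔m J₁ (J₂ ⊔ J₃)) le′
        in search-complete j n k l val
             (h₁ (≤-trans (m≤m⊔n J₁ _) le′))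
             (h₂ (≤-trans (m≤m⊔n J₂ _) le″))
             (h₃ (≤-trans (m≤n⊔m J₂ _) le″))
             k 0 j refl (≤-trans (m≤m⊔n (suc k) (J₁ ⊔ (J₂ ⊔ J₃))) le)

  query : (ℕ → Q) → ℕ → ℕ → D Q (Maybe X)
  query e _ n = ask (e n) (ret ∘ just)

  query-approximates : {o : Q → X} (e : ℕ → Q) → Approximates o (query e) (o ∘ e)
  sound    (query-approximates e) j n eq = sym (just-injective eq)
  complete (query-approximates e) n      = 0 , λ _ → refl

  O₁ O₂ O₃ : Set
  O₁ = ⊥ ⊎ ℕ
  O₂ = O₁ ⊎ ℕ
  O₃ = O₂ ⊎ ℕ

  kTree : ℕ → D O₁ X
  kTree = lam (query (inj₁ ∘ inj₂))

  kElement : ℕ → X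
  kElement = run ⊥-elim ∘ lamTotal kTree

  kLaw : ∀ α β → ∃ λ kα → kElement · α ↦ kα × kα · β ↦ α
  kLaw α β = _ , lamTotal-correct ⊥-elim kTree α ,
    lam-correct [ ⊥-elim , α ]′ (query (inj₁ ∘ inj₂)) β α
      (sound (query-approximates {o = [ [ ⊥-elim , α ]′ , β ]′} (inj₁ ∘ inj₂)))
      (λ n → 0 , refl)

  sTree₃ : ℕ → ℕ → D O₃ (Maybe X)
  sTree₃ = apply (apply (query (inj₁ ∘ inj₁ ∘ inj₂)) (query inj₂))
                 (apply (query (inj₁ ∘ inj₂)) (query inj₂))

  sTree₂ : ℕ → D O₂ X
  sTree₂ = lam sTree₃

  sTree₁ : ℕ → D O₁ X
  sTree₁ = lamTotal sTree₂

  sElement : ℕ → X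
  sElement = run ⊥-elim ∘ lamTotal sTree₁

  sLaw : ∀ α β → ∃₂ λ sα sαβ → sElement · α ↦ sα × sα · β ↦ sαβ ×
         (∀ {γ αγ βγ δ} → α · γ ↦ αγ → β · γ ↦ βγ → αγ · βγ ↦ δ → sαβ · γ ↦ δ)
  sLaw α β = _ , _ , lamTotal-correct ⊥-elim sTree₁ α ,
    lamTotal-correct [ ⊥-elim , α ]′ sTree₂ β ,
    λ {γ} {δ = δ} p q r →
      let approx = apply-approximates
            (apply-approximates (query-approximates (inj₁ ∘ inj₁ ∘ inj₂)) (query-approximates inj₂) p)
            (apply-approximates (query-approximates (inj₁ ∘ inj₂)) (query-approximates inj₂) q)
            r
      in lam-correct [ [ ⊥-elim , α ]′ , β ]′ sTree₃ γ δ (sound approx)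
           (λ n → let J , h = complete approx n in J , h ≤-refl)

module 𝒦₂-Construction (coding : List ℕ ↪ ℕ) where

  enc : Maybe ℕ → Maybe ℕ → ℕ
  enc _ = maybe suc 0

  open Construction coding id id (λ _ → refl) (_> 0) (0 <?_) id (λ w _ → w) (λ _ _ → refl)
    (_∸ 1) enc (λ ()) (λ _ → s≤s z≤n)
    (λ h k v eq _ → cong (λ c → maybe suc 0 c ∸ 1) eq) public

module 2^ω-Construction (coding : List ℕ ↪ ℕ) where

  bit : ℕ → Fin 2
  bit zero    = 0F
  bit (suc _) = 1F

  bit-toℕ : ∀ x → bit (toℕ x) ≡ x
  bit-toℕ 0F = refl
  bit-toℕ 1F = refl

  enc : Maybe (Fin 2) → Maybe (Fin 2) → Fin 2
  enc (just v) _ = v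
  enc nothing  c = maybe (λ _ → 1F) 0F c

  open Construction coding toℕ bit bit-toℕ (_≡ 1F) (Fin._≟ 1F) suc _∷ʳ_ applyUpTo-∷ʳ
    id enc (λ ()) (λ _ → refl)
    (λ h k v eq _ → cong (λ p → enc p (h (suc k))) eq) public

------------------------------------------------------------------------

module _ (coding : List ℕ ↪ ℕ) where

  𝒦₂ : PCA 0ℓ 0ℓ
  𝒦₂ = record
    { setoid       = ℕ →-setoid ℕ
    ; _·_↦_        = 𝒦₂-app coding
    ; ↦-resp       = ·↦-resp
    ; ↦-functional = λ {α} {β} → ·↦-functional {α} {β}
    ; k            = kElement
    ; k-law        = kLaw
    ; s            = sElement
    ; s-law        = sLaw
    }
    where
    open 𝒦₂-Construction coding

  2^ω : PCA 0ℓ 0ℓ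
  2^ω = record
    { setoid       = ℕ →-setoid Fin 2
    ; _·_↦_        = 2^ω-app coding
    ; ↦-resp       = ·↦-resp
    ; ↦-functional = λ {α} {β} → ·↦-functional {α} {β}
    ; k            = kElement
    ; k-law        = kLaw
    ; s            = sElement
    ; s-law        = sLaw
    }
    where
    open 2^ω-Construction coding

{-# OPTIONS --safe #-}
-- Mutually inverse relations with nonempty values are graphs of mutually inverse
-- bijections f : 2^ω → 𝒦₂ and g : 𝒦₂ → 2^ω.  For each m the map sending β to the
-- constant 0 or 1, according to whether β(0) = m, is realized in 𝒦₂; as g is
-- realized, the set of a with f(a)(0) = m is then cut out of 2^ω by a single
-- output digit of an application ρ · a, hence is open.  So a ↦ f(a)(0) is locally
-- constant on the compact space 2^ω and therefore bounded, but f is onto.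
module Submission where

open import Defs
open import Axiom.ExcludedMiddle using (ExcludedMiddle)
open import Data.Fin using (Fin; toℕ)
open import Data.Fin.Patterns using (0F; 1F)
open import Data.List using (List; _∷_; applyUpTo)
open import Data.Nat using (ℕ; zero; suc; _∸_; _>_; _≤_; _<_; _≟_; z<s; s<s; _⊔_)
open import Data.Nat.Properties using (≤-trans; ≤-refl; ≤-reflexive; <⇒≤; n≮n; m≤m⊔n; m≤n⊔m; m<n⇒m<1+n; n<1+n; <-≤-trans; 0≢1+n)
open import Data.Product using (∃; _,_; proj₁; proj₂)
open import Function using (_∘_; const)
open import Function.Bundles using (_↪_; RightInverse)
open import Level using (Level; 0ℓ)
open import Relation.Binary using (Setoid; _Preserves_⟶_)
open import Relation.Binary.PropositionalEquality using (_≡_; _≢_; refl; sym; trans; cong; cong₂; subst; _≗_)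
open import Relation.Nullary using (¬_; yes; no; contradiction)
open import Relation.Nullary.Decidable using (decidable-stable)

Agree : {A : Set} → ℕ → (a b : ℕ → A) → Set
Agree N a b = ∀ {i} → i < N → a i ≡ b i

applyUpTo-agree : ∀ {A B : Set} (f : A → B) {a b : ℕ → A} k → Agree k a b →
                  applyUpTo (f ∘ a) k ≡ applyUpTo (f ∘ b) k
applyUpTo-agree f zero    eq = refl
applyUpTo-agree f (suc k) eq = cong₂ _∷_ (cong f (eq z<s)) (applyUpTo-agree f k (eq ∘ s<s))

LocallyConstant : ((ℕ → Fin 2) → ℕ) → Set
LocallyConstant h = ∀ a → ∃ λ N → ∀ a′ → Agree N a a′ → h a ≡ h a′

Bounded : {A : Set} → (A → ℕ) → Set
Bounded h = ∃ λ B → ∀ a → h a ≤ B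

infixr 5 _◂_
_◂_ : {A : Set} → A → (ℕ → A) → ℕ → A
(x ◂ a) zero    = x
(x ◂ a) (suc n) = a n

◂-cong : {A : Set} {x : A} {a b : ℕ → A} → a ≗ b → x ◂ a ≗ x ◂ b
◂-cong eq zero    = refl
◂-cong eq (suc n) = eq n

◂-head-tail : {A : Set} (a : ℕ → A) → a 0 ◂ a ∘ suc ≗ a
◂-head-tail a zero    = refl
◂-head-tail a (suc n) = refl

module _ (em : ExcludedMiddle 0ℓ) where

  -- Bounds on the two halves would combine into their maximum. `ext` enters because a sequence is
  -- only pointwise equal to its head put before its tail.
  unbounded-half : (h : (ℕ → Fin 2) → ℕ) → h Preserves _≗_ ⟶ _≡_ → ¬ Bounded h →
                   ∃ λ x → ¬ Bounded (h ∘ (x ◂_))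
  unbounded-half h ext ¬bdd with em {Bounded (h ∘ (0F ◂_))} | em {Bounded (h ∘ (1F ◂_))}
  ... | no ¬bdd₀      | _             = 0F , ¬bdd₀
  ... | yes _         | no ¬bdd₁      = 1F , ¬bdd₁
  ... | yes (B₀ , p₀) | yes (B₁ , p₁) = contradiction (B₀ ⊔ B₁ , bound) ¬bdd
    where
    bound-◂ : ∀ x a → h (x ◂ a) ≤ B₀ ⊔ B₁
    bound-◂ 0F a = ≤-trans (p₀ a) (m≤m⊔n B₀ B₁)
    bound-◂ 1F a = ≤-trans (p₁ a) (m≤n⊔m B₀ B₁)

    bound : ∀ a → h a ≤ B₀ ⊔ B₁
    bound a = subst (_≤ B₀ ⊔ B₁) (ext (◂-head-tail a)) (bound-◂ (a 0) (a ∘ suc))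

  -- The path of König's lemma: each digit selects a half on which the restricted `h` stays
  -- unbounded.
  branch : (h : (ℕ → Fin 2) → ℕ) → h Preserves _≗_ ⟶ _≡_ → ¬ Bounded h → ℕ → Fin 2
  branch h ext ¬bdd = let x , ¬bddₓ = unbounded-half h ext ¬bdd in λ where
    zero    → x
    (suc n) → branch (h ∘ (x ◂_)) (ext ∘ ◂-cong) ¬bddₓ n

  -- Fixing the first digit replaces `h` by its restriction to the chosen half, so induction on `N`
  -- descends along the path.
  branch-unbounded : ∀ N h (ext : h Preserves _≗_ ⟶ _≡_) (¬bdd : ¬ Bounded h) →
                     ¬ (∃ λ B → ∀ a → Agree N (branch h ext ¬bdd) a → h a ≤ B)
  branch-unbounded zero    h ext ¬bdd (B , p) = ¬bdd (B , λ a → p a λ ())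
  branch-unbounded (suc N) h ext ¬bdd (B , p) =
    let x , ¬bddₓ = unbounded-half h ext ¬bdd in
    branch-unbounded N (h ∘ (x ◂_)) (ext ∘ ◂-cong) ¬bddₓ
      (B , λ a agree → p (x ◂ a) λ { {zero} _ → refl ; {suc i} (s<s lt) → agree lt })

  -- Otherwise `h` would be constant near `branch`, yet unbounded on every neighbourhood of it.
  locallyConstant⇒bounded : ∀ {h} → LocallyConstant h → Bounded h
  locallyConstant⇒bounded {h} lc = decidable-stable em λ ¬bdd →
    let a     = branch h ext ¬bdd
        N , c = lc a
    in branch-unbounded N h ext ¬bdd (h a , λ a′ agree → ≤-reflexive (sym (c a′ agree)))
    where
    -- Pointwise equal sequences agree to every length, so local constancy yields extensionality.
    ext : h Preserves _≗_ ⟶ _≡_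
    ext {a} {b} eq = proj₂ (lc a) b λ {i} _ → eq i

  ≇⇒differ : {a b : ℕ → Fin 2} → ¬ a ≗ b → ∃ λ n → a n ≢ b n
  ≇⇒differ a≇b = decidable-stable em λ none →
    a≇b λ n → decidable-stable em λ neq → none (n , neq)

mismatch : ℕ → ℕ → ℕ
mismatch m x with x ≟ m
... | yes _ = 0
... | no _  = 1

-- The value 0 asks for more input; `suc` offsets the 1 that application in `𝒦₂` subtracts.
headTestList : ℕ → List ℕ → ℕ
headTestList m (_ ∷ x ∷ _) = suc (mismatch m x)
headTestList m _           = 0

module _ (coding : List ℕ ↪ ℕ) where
  open RightInverse coding using () renaming (to to ⟦_⟧; from to decode; strictlyInverseʳ to decode∘code)

  2^ω-app-continuous : ∀ α β γ → 2^ω-app coding α β γ → ∀ n → ∃ λ N → ∀ β′ γ′ →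
                       Agree N β β′ → 2^ω-app coding α β′ γ′ → γ n ≡ γ′ n
  2^ω-app-continuous α β γ app n with app n
  -- Halting inspects `k` entries, but the value is read with one more, whence `suc k`.
  ... | k , (stop , below) , val = suc k , same
    where
    same : ∀ β′ γ′ → Agree (suc k) β β′ → 2^ω-app coding α β′ γ′ → γ n ≡ γ′ n
    same β′ γ′ agree app′ with app′ n
    ... | k′ , least′ , val′ = trans val (trans (read ≤-refl) (trans (cong reading k≡k′) (sym val′)))
      where
      reading : ℕ → Fin 2
      reading j = α ⟦ n ∷ applyUpTo (toℕ ∘ β′) (suc j) ⟧

      read : ∀ {j} → j ≤ suc k →
             α ⟦ n ∷ applyUpTo (toℕ ∘ β) j ⟧ ≡ α ⟦ n ∷ applyUpTo (toℕ ∘ β′) j ⟧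
      read {j} le = cong (λ u → α ⟦ n ∷ u ⟧) (applyUpTo-agree toℕ j λ lt → agree (<-≤-trans lt le))

      k≡k′ : k ≡ k′
      k≡k′ = least-unique {P = λ j → α ⟦ n ∷ applyUpTo (toℕ ∘ β′) j ⟧ ≡ 1F}
        ( trans (sym (read (<⇒≤ (n<1+n k)))) stop
        , λ lt eq → below lt (trans (read (<⇒≤ (m<n⇒m<1+n lt))) eq))
        least′

  headTest : ℕ → ℕ → ℕ
  headTest m = headTestList m ∘ decode

  headTest-app : ∀ m β → 𝒦₂-app coding (headTest m) β (const (mismatch m (β 0)))
  headTest-app m β n =
    -- The code of `n` alone gives 0; the single entry `β 0` already settles the test.
    1 ,
    ( subst (_> 0) (sym (headTest-code 1)) z<s
    , λ { {zero} _ stop → n≮n 0 (subst (_> 0) (headTest-code 0) stop) ; {suc _} (s<s ()) }) ,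
    sym (cong (_∸ 1) (headTest-code 1))
    where
    headTest-code : ∀ j → headTest m ⟦ n ∷ applyUpTo β j ⟧ ≡ headTestList m (n ∷ applyUpTo β j)
    headTest-code j = cong (headTestList m) (decode∘code (n ∷ applyUpTo β j))

module Inverse {c₁ ℓ₁ c₂ ℓ₂ p} {𝒜 : PCA c₁ ℓ₁} {ℬ : PCA c₂ ℓ₂} (iso : Isomorphism p 𝒜 ℬ) where
  private
    module A = PCA 𝒜
    module B = PCA ℬ
    module A≈ = Setoid A.setoid
    module B≈ = Setoid B.setoid
  open Isomorphism iso
  private
    module T = ApplicativeMorphism to
    module F = ApplicativeMorphism from

  f : A.Carrier → B.Carrier
  f a = proj₁ (T.nonempty a)

  g : B.Carrier → A.Carrier
  g b = proj₁ (F.nonempty b)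

  g-graph : ∀ b → F.γ b (g b)
  g-graph b = proj₂ (F.nonempty b)

  f-inverse-graph : ∀ a → F.γ (f a) a
  f-inverse-graph a =
    F.γ-resp B≈.refl (A≈.sym (proj₁ from∘to (f a , proj₂ (T.nonempty a) , g-graph (f a)))) (g-graph (f a))

  -- Any `b′` related to `a` is equal to `b` by one composite, hence is related to `a′` too; the
  -- other composite then identifies `a` with `a′`.
  from-functional : ∀ {b a a′} → F.γ b a → F.γ b a′ → a A.≈ a′
  from-functional {a = a} ba ba′ =
    let b′ , ab′ = T.nonempty a
        b≈b′     = proj₁ to∘from (a , ba , ab′)
    in proj₁ from∘to (b′ , ab′ , F.γ-resp b≈b′ A≈.refl ba′)

  from-injective : ∀ {b b′ a} → F.γ b a → F.γ b′ a → b B.≈ b′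
  from-injective {a = a} ba b′a =
    let b″ , ab″ = T.nonempty a
    in B≈.trans (proj₁ to∘from (a , ba , ab″)) (B≈.sym (proj₁ to∘from (a , b′a , ab″)))

  f-g : ∀ b → f (g b) B.≈ b
  f-g b = from-injective (f-inverse-graph (g b)) (g-graph b)

  g-injective : ∀ {b b′} → g b A.≈ g b′ → b B.≈ b′
  g-injective {b} {b′} eq = from-injective (F.γ-resp B≈.refl eq (g-graph b)) (g-graph b′)

  -- The application at a₀ is what makes r · g(b) defined, for r a realizer of from.
  realize : ∀ b a₀ {b₀} → b B.· f a₀ ↦ b₀ →
            ∃ λ ρ → ∀ a {b′} → b B.· f a ↦ b′ → ρ A.· a ↦ g b′
  realize b a₀ app₀ =
    let r , track          = F.realizer
        ρ , _ , r·gb↦ρ , _ = track app₀ (g-graph b) (f-inverse-graph a₀)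
    in ρ , λ a app →
      let ρ′ , _ , r·gb↦ρ′ , ρ′·a↦c , b′c = track app (g-graph b) (f-inverse-graph a)
      in A.↦-resp (A.↦-functional r·gb↦ρ′ r·gb↦ρ) A≈.refl (from-functional b′c (g-graph _)) ρ′·a↦c

proposition2p16 : ExcludedMiddle 0ℓ → (coding : List ℕ ↪ ℕ) (p : Level) → ¬ Isomorphism p (2^ω coding) (𝒦₂ coding)
-- By surjectivity of `f`, some sequence is sent to a constant function just above the bound.
proposition2p16 em coding p iso = n≮n B (subst (_≤ B) (f-g (const (suc B)) 0) (bound (g (const (suc B)))))
  where
  open Inverse iso

  -- The two possible answers of the test have distinct images under `g`, so one digit tells them
  -- apart.
  separation : ∃ λ n → g (const 0) n ≢ g (const 1) n
  separation = ≇⇒differ em λ eq → 0≢1+n (g-injective eq 0)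

  n : ℕ
  n = proj₁ separation

  -- `mismatch m m` stands in place of 0 because the test at `a` returns this form when `m` is
  -- `f a 0`.
  mismatch-separated : ∀ m x → g (const (mismatch m m)) n ≡ g (const (mismatch m x)) n → m ≡ x
  mismatch-separated m x eq with m ≟ m | x ≟ m
  ... | no m≢m | _       = contradiction refl m≢m
  ... | yes _  | yes x≡m = sym x≡m
  ... | yes _  | no _    = contradiction eq (proj₂ separation)

  locallyConstant : LocallyConstant λ a → f a 0
  locallyConstant a =
    -- The test may depend on `a`: only nearby `a′` are compared with it, through digit `n` of the
    -- output of `ρ`.
    let m        = f a 0
        ρ , app  = realize (headTest coding m) a (headTest-app coding m (f a))
        N , cont = 2^ω-app-continuous coding ρ a _ (app a (headTest-app coding m (f a))) n
    in N , λ a′ agree →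
      mismatch-separated m (f a′ 0) (cont a′ _ agree (app a′ (headTest-app coding m (f a′))))

  bounded : Bounded λ a → f a 0
  bounded = locallyConstant⇒bounded em locallyConstant

  B : ℕ
  B = proj₁ bounded

  bound : ∀ a → f a 0 ≤ B
  bound = proj₂ bounded
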